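{- Let $\Delta_n$ ($n\ge 0$) be as defined in the context. Then, as an identity of power series (convergent in a neighborhood of $t=0$), $$f(t):=\sum_{n\ge 0}\Delta_n (2t)^n=\frac12\,\frac{1}{\sqrt{(1-t)(1-2t)(2t^2+t+1)}}-\frac12\,\frac{1}{1-t},$$ where the square root is the branch equal to $1$ at $t=0$.
   Context: A fair coin is flipped $n$ times, producing a sequence $x_1,\dots,x_n\in\{H,T\}$ of independent uniformly random outcomes. Alice's score is the number of indices $i\in\{1,\dots,n-1\}$ with $(x_i,x_{i+1})=(H,H)$; Bob's score is the number of indices $i\in\{1,\dots,n-1\}$ with $(x_i,x_{i+1})=(H,T)$. Let $P_n(\mathrm{Bob})$ be the probability that Bob's score is strictly larger than Alice's, $P_n(\mathrm{Alice})$ the probability that Alice's score is strictly larger than Bob's, and $\Delta_n=P_n(\mathrm{Bob})-P_n(\mathrm{Alice})$ (so $\Delta_0=0$). -}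

module Defs where

open import Algebra.Bundles using (CommutativeRing)
open import Data.Bool.Base using (true; false; if_then_else_)
open import Data.Fin.Base using (toℕ)
open import Data.Fin.Properties using (toℕ-fromℕ; toℕ-inject₁; toℕ<n)
open import Data.Integer.Base using (+_)
open import Data.List.Base using (List; []; _∷_; _++_; map; filter; length)
open import Data.Nat.Base as ℕ using (ℕ; zero; suc; _∸_; _≡ᵇ_; s≤s; z≤n)
import Data.Nat.Properties as ℕₚ
open import Data.Product.Base using (_×_; _,_; ∃-syntax)
open import Data.Product.Properties using (≡-dec)
open import Data.Rational.Base using (ℚ; 0ℚ; 1ℚ; ½; _+_; _*_; _-_; _/_; 1/_; ∣_∣; _<_; _≤_; NonZero; +-*-rawSemiring)
open import Data.Rational.Properties using (+-*-commutativeRing; *-inverseʳ; *-assoc)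
open import Data.Rational.Solver using (module +-*-Solver)
open import Data.Sum.Base using (inj₁; inj₂)
open import Data.Vec.Base using (Vec; []; _∷_)
open import Level using (0ℓ)
open import Relation.Binary.Definitions using (DecidableEquality)
open import Relation.Binary.PropositionalEquality using (_≡_; refl; sym; trans; cong; cong₂; module ≡-Reasoning)
open import Relation.Nullary.Decidable using (yes; no)
open import Relation.Unary using (Pred; Decidable)

open import Algebra.Properties.Semiring.Sum (CommutativeRing.semiring +-*-commutativeRing)
  using (sum-syntax; sum⁺-syntax; sum-cong-≗; sum-init-last)
open import Algebra.Definitions.RawSemiring +-*-rawSemiring using (_^_)

2ℚ : ℚ
2ℚ = + 2 / 1

data Coin : Set where
  H T : Coin

_≟_ : DecidableEquality Coin
H ≟ H = yes refl
H ≟ T = no λ ()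
T ≟ H = no λ ()
T ≟ T = yes refl

outcomes : ∀ n → List (Vec Coin n)
outcomes zero    = [] ∷ []
outcomes (suc n) = map (H ∷_) (outcomes n) ++ map (T ∷_) (outcomes n)

probability : ∀ {n} {E : Pred (Vec Coin n) 0ℓ} → Decidable E → ℚ
probability {n} E? = (+ length (filter E? (outcomes n)) / (2 ℕ.^ n)) {{ℕₚ.m^n≢0 2 n}}

-- (x₁ , x₂) , (x₂ , x₃) , … , (xₙ₋₁ , xₙ)
consecutive : ∀ {n} → Vec Coin n → List (Coin × Coin)
consecutive []           = []
consecutive (x ∷ [])     = []
consecutive (x ∷ y ∷ xs) = (x , y) ∷ consecutive (y ∷ xs)

score : Coin × Coin → ∀ {n} → Vec Coin n → ℕ
score p xs = length (filter (≡-dec _≟_ _≟_ p) (consecutive xs))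

alice bob : ∀ {n} → Vec Coin n → ℕ
alice = score (H , H)
bob   = score (H , T)

P-Bob P-Alice Δ : ℕ → ℚ
P-Bob   n = probability {n} (λ xs → alice xs ℕₚ.<? bob xs)
P-Alice n = probability {n} (λ xs → bob xs ℕₚ.<? alice xs)
Δ       n = P-Bob n - P-Alice n

PowerSeries : Set
PowerSeries = ℕ → ℚ

infix  4 _≈_
infixl 6 _⊕_ _⊖_
infixl 7 _⊛_
infixr 8 _·_

_≈_ : PowerSeries → PowerSeries → Set
a ≈ b = ∀ n → a n ≡ b n

𝟏 𝐭 : PowerSeries
𝟏 zero    = 1ℚ
𝟏 (suc _) = 0ℚ
𝐭 1 = 1ℚ
𝐭 _ = 0ℚ

_⊕_ _⊖_ _⊛_ : PowerSeries → PowerSeries → PowerSeries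
(a ⊕ b) n = a n + b n
(a ⊖ b) n = a n - b n
(a ⊛ b) n = ∑[ i ≤ n ] (a (toℕ i) * b (n ∸ toℕ i))

_·_ : ℚ → PowerSeries → PowerSeries
(c · a) n = c * a n

-- Course-of-values recursion: the n-th coefficient of `build step` is
-- computed by `step n` from the coefficients below n, which are presented as
-- the series `truncated step n` whose coefficients from n onwards are 0.
truncated : (ℕ → PowerSeries → ℚ) → ℕ → PowerSeries
truncated step zero    k = 0ℚ
truncated step (suc n) k =
  if k ≡ᵇ n then step n (truncated step n) else truncated step n k

build : (ℕ → PowerSeries → ℚ) → PowerSeries
build step n = step n (truncated step n)

-- The coefficient of tⁿ in a ⊛ r is a₀ rₙ plus its value for r cut off below n,
-- so rₙ is forced by a ⊛ r ≈ 𝟏; see recip-inverse.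
recip : (a : PowerSeries) → .{{NonZero (a 0)}} → PowerSeries
recip a = build λ n r → 1/ (a 0) * (𝟏 n - (a ⊛ r) n)

-- The square root with constant coefficient 1.  For n > 0 the coefficient of
-- tⁿ in s ⊛ s is 2 sₙ plus its value for s cut off below n; see sqrt-square.
sqrt-step : PowerSeries → ℕ → PowerSeries → ℚ
sqrt-step p zero    s = 1ℚ
sqrt-step p (suc n) s = ½ * (p (suc n) - (s ⊛ s) (suc n))

sqrt : (p : PowerSeries) → .(p 0 ≡ 1ℚ) → PowerSeries
sqrt p _ = build (sqrt-step p)

-- Convergence of the partial sums in ℝ is expressed by the Cauchy property,
-- because the limit need not be rational.
Cauchy : (ℕ → ℚ) → Set
Cauchy u = ∀ ε → 0ℚ < ε → ∃[ N ] (∀ m n → N ℕ.≤ m → N ℕ.≤ n → ∣ u m - u n ∣ < ε)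

-- Absolute convergence at the rational points of [-r , r] with r > 0; by
-- comparison this gives convergence at every complex point with |t| ≤ r.
ConvergesNearZero : PowerSeries → Set
ConvergesNearZero a =
  ∃[ r ] (0ℚ < r × (∀ t → ∣ t ∣ ≤ r → Cauchy (λ N → ∑[ i < N ] ∣ a (toℕ i) * t ^ toℕ i ∣)))

-- ∑ Δₙ (2t)ⁿ
f : PowerSeries
f n = Δ n * 2ℚ ^ n

radicand : PowerSeries
radicand = (𝟏 ⊖ 𝐭) ⊛ (𝟏 ⊖ 2ℚ · 𝐭) ⊛ (2ℚ · (𝐭 ⊛ 𝐭) ⊕ 𝐭 ⊕ 𝟏)

private
  ≡ᵇ-refl : ∀ n → (n ≡ᵇ n) ≡ true
  ≡ᵇ-refl zero    = refl
  ≡ᵇ-refl (suc n) = ≡ᵇ-refl n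

  <⇒≡ᵇ-false : ∀ {k n} → k ℕ.< n → (k ≡ᵇ n) ≡ false
  <⇒≡ᵇ-false {zero}  {suc n} _         = refl
  <⇒≡ᵇ-false {suc k} {suc n} (s≤s k<n) = <⇒≡ᵇ-false k<n

  >⇒≡ᵇ-false : ∀ {k n} → n ℕ.< k → (k ≡ᵇ n) ≡ false
  >⇒≡ᵇ-false {suc k} {zero}  _         = refl
  >⇒≡ᵇ-false {suc k} {suc n} (s≤s n<k) = >⇒≡ᵇ-false n<k

truncated-≥ : ∀ step n k → n ℕ.≤ k → truncated step n k ≡ 0ℚ
truncated-≥ step zero    k _ = refl
truncated-≥ step (suc n) k n<k rewrite >⇒≡ᵇ-false n<k = truncated-≥ step n k (ℕₚ.<⇒≤ n<k)

truncated-< : ∀ step n k → k ℕ.< n → truncated step n k ≡ build step k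
truncated-< step (suc n) k (s≤s k≤n) with ℕₚ.m≤n⇒m<n∨m≡n k≤n
... | inj₁ k<n  rewrite <⇒≡ᵇ-false k<n = truncated-< step n k k<n
... | inj₂ refl rewrite ≡ᵇ-refl k = refl

recip-inverse : ∀ a .{{_ : NonZero (a 0)}} → a ⊛ recip a ≈ 𝟏
recip-inverse a n = begin
  a 0 * r n + rest r                   ≡⟨ cong (λ z → a 0 * r n + z) rest≡ ⟨
  a 0 * r n + rest r′                  ≡⟨ cong (_+ rest r′) (*-assoc (a 0) c _) ⟨
  a 0 * c * (𝟏 n - (a ⊛ r′) n) + rest r′
    ≡⟨ cong (λ z → z * (𝟏 n - (a ⊛ r′) n) + rest r′) (*-inverseʳ (a 0)) ⟩
  1ℚ * (𝟏 n - (a 0 * r′ n + rest r′)) + rest r′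
    ≡⟨ cong (λ z → 1ℚ * (𝟏 n - (a 0 * z + rest r′)) + rest r′) (truncated-≥ step n n ℕₚ.≤-refl) ⟩
  1ℚ * (𝟏 n - (a 0 * 0ℚ + rest r′)) + rest r′
    ≡⟨ solve 3 (λ x y z → con 1ℚ :* (x :- (y :* con 0ℚ :+ z)) :+ z := x) refl (𝟏 n) (a 0) (rest r′) ⟩
  𝟏 n                                  ∎
  where
  open ≡-Reasoning
  open +-*-Solver
  c    = 1/ (a 0)
  step : ℕ → PowerSeries → ℚ
  step = λ n r → 1/ (a 0) * (𝟏 n - (a ⊛ r) n)
  r r′ : PowerSeries
  r    = recip a
  r′   = truncated step n
  rest : PowerSeries → ℚ
  rest u = ∑[ i < n ] (a (suc (toℕ i)) * u (n ∸ suc (toℕ i)))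
  rest≡ : rest r′ ≡ rest r
  rest≡ = sum-cong-≗ {n} λ i → cong (a (suc (toℕ i)) *_)
    (truncated-< step n _ (ℕₚ.∸-monoʳ-< {n} {suc (toℕ i)} {0} (s≤s z≤n) (toℕ<n i)))

private
  middle : PowerSeries → ℕ → ℚ
  middle s n = ∑[ i < n ] (s (suc (toℕ i)) * s (n ∸ toℕ i))

  square-suc : ∀ s n → (s ⊛ s) (suc n) ≡ s 0 * s (suc n) + (middle s n + s (suc n) * s 0)
  square-suc s n = cong (λ z → s 0 * s (suc n) + z) (trans
    (sum-init-last {n} (λ i → s (suc (toℕ i)) * s (n ∸ toℕ i)))
    (cong₂ _+_
      (sum-cong-≗ {n} λ i → cong (λ k → s (suc k) * s (n ∸ k)) (toℕ-inject₁ i))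
      (trans (cong (λ k → s (suc k) * s (n ∸ k)) (toℕ-fromℕ n))
             (cong (λ k → s (suc n) * s k) (ℕₚ.n∸n≡0 n)))))

sqrt-square : ∀ p .(p₀≡1 : p 0 ≡ 1ℚ) → sqrt p p₀≡1 ⊛ sqrt p p₀≡1 ≈ p
sqrt-square p p₀≡1 zero    = sym (≡-recompute p₀≡1)
  where
  open import Data.Rational.Properties using () renaming (_≟_ to _≟ℚ_)
  open import Relation.Nullary.Decidable using (recompute)
  ≡-recompute : .(p 0 ≡ 1ℚ) → p 0 ≡ 1ℚ
  ≡-recompute = recompute (p 0 ≟ℚ 1ℚ)
sqrt-square p p₀≡1 (suc n) = begin
  (s ⊛ s) (suc n)                                 ≡⟨ square-suc s n ⟩
  1ℚ * s (suc n) + (middle s n + s (suc n) * 1ℚ)  ≡⟨ cong (λ m → 1ℚ * s (suc n) + (m + s (suc n) * 1ℚ)) middle≡ ⟨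
  1ℚ * s (suc n) + (M + s (suc n) * 1ℚ)           ≡⟨ cong (λ x → 1ℚ * x + (M + x * 1ℚ)) sₙ ⟩
  1ℚ * (½ * (p (suc n) - M)) + (M + ½ * (p (suc n) - M) * 1ℚ)
    ≡⟨ solve 2 (λ x m → con 1ℚ :* (con ½ :* (x :- m)) :+ (m :+ con ½ :* (x :- m) :* con 1ℚ) := x) refl (p (suc n)) M ⟩
  p (suc n)                                       ∎
  where
  open ≡-Reasoning
  open +-*-Solver
  s s′ : PowerSeries
  s  = sqrt p p₀≡1
  s′ = truncated (sqrt-step p) (suc n)
  M  = middle s′ n
  middle≡ : M ≡ middle s n
  middle≡ = sum-cong-≗ {n} λ i → cong₂ _*_
    (truncated-< (sqrt-step p) (suc n) _ (s≤s (toℕ<n i)))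
    (truncated-< (sqrt-step p) (suc n) _ (s≤s (ℕₚ.m∸n≤m n (toℕ i))))
  sₙ : s (suc n) ≡ ½ * (p (suc n) - M)
  sₙ = cong (λ x → ½ * (p (suc n) - x)) (begin
    (s′ ⊛ s′) (suc n)                                     ≡⟨ square-suc s′ n ⟩
    s′ 0 * s′ (suc n) + (M + s′ (suc n) * s′ 0)
      ≡⟨ cong (λ x → s′ 0 * x + (M + x * s′ 0)) (truncated-≥ (sqrt-step p) (suc n) (suc n) ℕₚ.≤-refl) ⟩
    s′ 0 * 0ℚ + (M + 0ℚ * s′ 0)
      ≡⟨ solve 2 (λ x m → x :* con 0ℚ :+ (m :+ con 0ℚ :* x) := m) refl (s′ 0) M ⟩
    M                                                     ∎)

{-# OPTIONS --safe #-}
-- Put sgn (p + bob) (q + alice) = ±1 or 0 according to who leads when Bob starts p and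
-- Alice q points ahead.  Its sums over all outcomes following a given T or H satisfy a
-- recurrence in n that changes p − q by at most one, so in terms of k = p − q their
-- generating functions 𝒯 and ℋ are the unique solution of
--   𝒯ₖ = sgn k + t (𝒯ₖ + ℋₖ),   ℋₖ = sgn k + t (ℋₖ₋₁ + 𝒯ₖ₊₁).
-- Modulo the constant solutions ±1/(1−2t), λᵏ solves this iff t²λ² − (1−t)λ + t(1−t) = 0.
-- The roots are β = (1−t−s)/(2t²) and 1/α with α = tβ/(1−t), where s² is the radicand;
-- powers of β serve for k > 0 and powers of α for k < 0.  Matching at k = 0 fixes the
-- two amplitudes, and f = 𝒯₀ simplifies to ½ (1/s − 1/(1−t)).
-- Convergence follows from |f n| ≤ 2ⁿ.
module Submission where

open import Defs
open import Algebra.Bundles using (CommutativeRing)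
open import Algebra.Solver.Ring.AlmostCommutativeRing using (_-Raw-AlmostCommutative⟶_; fromCommutativeRing)
import Algebra.Solver.Ring
open import Data.Fin.Base using (toℕ)
open import Data.Fin.Properties using (toℕ-fromℕ; toℕ-inject₁)
open import Data.Integer.Base as ℤ using ()
import Data.Integer.Properties as ℤₚ
open import Data.List.Base using (List; []; _∷_; _++_; map; filter; length)
open import Data.List.Properties using (filter-accept; filter-reject)
import Data.Maybe.Base as Maybe
open import Data.Nat.Base as ℕ using (ℕ; zero; suc; s≤s)
import Data.Nat.Properties as ℕₚ
open import Data.Product.Base using (_×_; _,_)
open import Data.Rational.Base using (ℚ; mkℚ; 0ℚ; 1ℚ; ½; _+_; _*_; _-_; -_; _/_; ∣_∣; _≤_; _<_; ↧ₙ_; positive; nonNegative; +-*-rawSemiring; toℚᵘ)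
import Data.Rational.Properties as ℚₚ
open import Data.Rational.Solver using (module +-*-Solver)
open import Data.Rational.Unnormalised.Base as ℚᵘ using (mkℚᵘ; *≡*)
import Data.Rational.Unnormalised.Properties as ℚᵘₚ
open import Data.Sum.Base using (inj₁; inj₂)
open import Data.Vec.Base using (Vec; []; _∷_)
open import Function.Base using (_∘_)
open import Level using (0ℓ)
open import Relation.Binary.Definitions using (Tri; tri<; tri≈; tri>)
open import Relation.Binary.PropositionalEquality using (_≡_; refl; sym; trans; cong; cong₂; module ≡-Reasoning)
open import Relation.Nullary.Decidable using (Dec; dec⇒maybe)
open import Relation.Nullary.Negation using (¬_)
open import Relation.Unary using (Pred; Decidable)

open import Algebra.Definitions.RawSemiring +-*-rawSemiring using (_^_)
open import Algebra.Properties.Semiring.Sum (CommutativeRing.semiring ℚₚ.+-*-commutativeRing)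
  using (sum-syntax; sum-cong-≗; sum-init-last)

-- Power series as a commutative ring

tail : PowerSeries → PowerSeries
tail a n = a (suc n)

const : ℚ → PowerSeries
const c zero    = c
const c (suc _) = 0ℚ

⊖_ : PowerSeries → PowerSeries
(⊖ a) n = - a n

≈-refl : ∀ {a} → a ≈ a
≈-refl n = refl

≈-sym : ∀ {a b} → a ≈ b → b ≈ a
≈-sym a≈b n = sym (a≈b n)

≈-trans : ∀ {a b c} → a ≈ b → b ≈ c → a ≈ c
≈-trans a≈b b≈c n = trans (a≈b n) (b≈c n)

⊕-cong : ∀ {a b c d} → a ≈ b → c ≈ d → a ⊕ c ≈ b ⊕ d
⊕-cong a≈b c≈d n = cong₂ _+_ (a≈b n) (c≈d n)

-- By definition `(a ⊛ b) (suc n)` unfolds to `a 0 * b (suc n) + (tail a ⊛ b) n`. This and most ring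
-- laws below are therefore inductions on the coefficient index with `a` replaced by `tail a`.
⊛-cong : ∀ {a b c d} → a ≈ b → c ≈ d → a ⊛ c ≈ b ⊛ d
⊛-cong a≈b c≈d zero    = cong (_+ 0ℚ) (cong₂ _*_ (a≈b 0) (c≈d 0))
⊛-cong {a} {b} a≈b c≈d (suc n) = cong₂ _+_
  (cong₂ _*_ (a≈b 0) (c≈d (suc n)))
  (⊛-cong {tail a} {tail b} (λ k → a≈b (suc k)) c≈d n)

⊛-congˡ : ∀ a {b c} → b ≈ c → a ⊛ b ≈ a ⊛ c
⊛-congˡ a = ⊛-cong {a} (λ _ → refl)

⊛-congʳ : ∀ a {b c} → b ≈ c → b ⊛ a ≈ c ⊛ a
⊛-congʳ a b≈c = ⊛-cong b≈c (λ (_ : ℕ) → refl)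

⊛-distribʳ : ∀ c a b → (a ⊕ b) ⊛ c ≈ a ⊛ c ⊕ b ⊛ c
⊛-distribʳ c a b zero = solve 3
  (λ x y z → (x :+ y) :* z :+ con 0ℚ := (x :* z :+ con 0ℚ) :+ (y :* z :+ con 0ℚ)) refl (a 0) (b 0) (c 0)
  where open +-*-Solver
⊛-distribʳ c a b (suc n) = trans
  (cong ((a 0 + b 0) * c (suc n) +_) (⊛-distribʳ c (tail a) (tail b) n))
  (solve 5 (λ x y z p q → (x :+ y) :* z :+ (p :+ q) := (x :* z :+ p) :+ (y :* z :+ q)) refl
    (a 0) (b 0) (c (suc n)) ((tail a ⊛ c) n) ((tail b ⊛ c) n))
  where open +-*-Solver

·-⊛-assoc : ∀ x a b → (x · a) ⊛ b ≈ x · (a ⊛ b)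
·-⊛-assoc x a b zero = solve 3
  (λ x y z → x :* y :* z :+ con 0ℚ := x :* (y :* z :+ con 0ℚ)) refl x (a 0) (b 0)
  where open +-*-Solver
·-⊛-assoc x a b (suc n) = trans
  (cong (x * a 0 * b (suc n) +_) (·-⊛-assoc x (tail a) b n))
  (solve 4 (λ x y z p → x :* y :* z :+ x :* p := x :* (y :* z :+ p)) refl
    x (a 0) (b (suc n)) ((tail a ⊛ b) n))
  where open +-*-Solver

-- Splits off the last summand where the definition splits off the first; comparing the two gives
-- commutativity.
⊛-suc : ∀ a b n → (a ⊛ b) (suc n) ≡ (a ⊛ tail b) n + a (suc n) * b 0
⊛-suc a b zero = solve 4
  (λ x y z w → x :* y :+ (z :* w :+ con 0ℚ) := x :* y :+ con 0ℚ :+ z :* w) refl (a 0) (b 1) (a 1) (b 0)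
  where open +-*-Solver
⊛-suc a b (suc n) = trans
  (cong (a 0 * b (suc (suc n)) +_) (⊛-suc (tail a) b n))
  (sym (ℚₚ.+-assoc (a 0 * b (suc (suc n))) ((tail a ⊛ tail b) n) (a (suc (suc n)) * b 0)))

⊛-comm : ∀ a b → a ⊛ b ≈ b ⊛ a
⊛-comm a b zero    = cong (_+ 0ℚ) (ℚₚ.*-comm (a 0) (b 0))
⊛-comm a b (suc n) = begin
  a 0 * b (suc n) + (tail a ⊛ b) n  ≡⟨ cong₂ _+_ (ℚₚ.*-comm (a 0) (b (suc n))) (⊛-comm (tail a) b n) ⟩
  b (suc n) * a 0 + (b ⊛ tail a) n  ≡⟨ ℚₚ.+-comm (b (suc n) * a 0) ((b ⊛ tail a) n) ⟩
  (b ⊛ tail a) n + b (suc n) * a 0  ≡⟨ ⊛-suc b a n ⟨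
  (b ⊛ a) (suc n)                   ∎
  where open ≡-Reasoning

⊛-assoc : ∀ a b c → (a ⊛ b) ⊛ c ≈ a ⊛ (b ⊛ c)
⊛-assoc a b c zero = solve 3
  (λ x y z → (x :* y :+ con 0ℚ) :* z :+ con 0ℚ := x :* (y :* z :+ con 0ℚ) :+ con 0ℚ) refl (a 0) (b 0) (c 0)
  where open +-*-Solver
⊛-assoc a b c (suc n) = begin
  -- `tail (a ⊛ b)` is by definition `a 0 · tail b ⊕ tail a ⊛ b`.
  (a ⊛ b) 0 * c (suc n) + ((a 0 · tail b ⊕ tail a ⊛ b) ⊛ c) n
    ≡⟨ cong ((a ⊛ b) 0 * c (suc n) +_) (⊛-distribʳ c (a 0 · tail b) (tail a ⊛ b) n) ⟩
  (a ⊛ b) 0 * c (suc n) + (((a 0 · tail b) ⊛ c) n + ((tail a ⊛ b) ⊛ c) n)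
    ≡⟨ cong ((a ⊛ b) 0 * c (suc n) +_) (cong₂ _+_ (·-⊛-assoc (a 0) (tail b) c n) (⊛-assoc (tail a) b c n)) ⟩
  (a 0 * b 0 + 0ℚ) * c (suc n) + (a 0 * (tail b ⊛ c) n + (tail a ⊛ (b ⊛ c)) n)
    ≡⟨ solve 5 (λ x y z p q → (x :* y :+ con 0ℚ) :* z :+ (x :* p :+ q) := x :* (y :* z :+ p) :+ q) refl
         (a 0) (b 0) (c (suc n)) ((tail b ⊛ c) n) ((tail a ⊛ (b ⊛ c)) n) ⟩
  (a ⊛ (b ⊛ c)) (suc n) ∎
  where
  open ≡-Reasoning
  open +-*-Solver

const-0 : const 0ℚ ≈ (λ _ → 0ℚ)
const-0 zero    = refl
const-0 (suc n) = refl

const-⊛ : ∀ c a → const c ⊛ a ≈ c · a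
const-⊛ c a zero    = ℚₚ.+-identityʳ (c * a 0)
const-⊛ c a (suc n) = trans (cong (c * a (suc n) +_) (zero-⊛ a n)) (ℚₚ.+-identityʳ (c * a (suc n)))
  where
  zero-⊛ : ∀ a n → ((λ _ → 0ℚ) ⊛ a) n ≡ 0ℚ
  zero-⊛ a zero    = trans (ℚₚ.+-identityʳ (0ℚ * a 0)) (ℚₚ.*-zeroˡ (a 0))
  zero-⊛ a (suc n) = cong₂ _+_ (ℚₚ.*-zeroˡ (a (suc n))) (zero-⊛ a n)

⊛-identityˡ : ∀ a → const 1ℚ ⊛ a ≈ a
⊛-identityˡ a n = trans (const-⊛ 1ℚ a n) (ℚₚ.*-identityˡ (a n))

powerSeriesRing : CommutativeRing 0ℓ 0ℓ
powerSeriesRing = record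
  { Carrier = PowerSeries ; _≈_ = _≈_ ; _+_ = _⊕_ ; _*_ = _⊛_ ; -_ = ⊖_
  ; 0# = λ _ → 0ℚ ; 1# = const 1ℚ
  ; isCommutativeRing = record
    { isRing = record
      { +-isAbelianGroup = record
        { isGroup = record
          { isMonoid = record
            { isSemigroup = record
              { isMagma = record
                { isEquivalence = record
                  { refl  = λ {a} → ≈-refl {a}
                  ; sym   = λ {a} {b} → ≈-sym {a} {b}
                  ; trans = λ {a} {b} {c} → ≈-trans {a} {b} {c} }
                ; ∙-cong = λ {a} {b} {c} {d} → ⊕-cong {a} {b} {c} {d} }
              ; assoc = λ a b c n → ℚₚ.+-assoc (a n) (b n) (c n) }
            ; identity = (λ a n → ℚₚ.+-identityˡ (a n)) , (λ a n → ℚₚ.+-identityʳ (a n)) }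
          ; inverse = (λ a n → ℚₚ.+-inverseˡ (a n)) , (λ a n → ℚₚ.+-inverseʳ (a n))
          ; ⁻¹-cong = λ a≈b n → cong -_ (a≈b n) }
        ; comm = λ a b n → ℚₚ.+-comm (a n) (b n) }
      ; *-cong = λ {a} {b} {c} {d} → ⊛-cong {a} {b} {c} {d}
      ; *-assoc = ⊛-assoc
      ; *-identity = ⊛-identityˡ , λ a → ≈-trans {a ⊛ const 1ℚ} (⊛-comm a (const 1ℚ)) (⊛-identityˡ a)
      ; distrib = (λ c a b n → begin
            (c ⊛ (a ⊕ b)) n          ≡⟨ ⊛-comm c (a ⊕ b) n ⟩
            ((a ⊕ b) ⊛ c) n          ≡⟨ ⊛-distribʳ c a b n ⟩
            (a ⊛ c) n + (b ⊛ c) n    ≡⟨ cong₂ _+_ (⊛-comm a c n) (⊛-comm b c n) ⟩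
            (c ⊛ a) n + (c ⊛ b) n    ∎)
        , ⊛-distribʳ }
    ; *-comm = ⊛-comm } }
  where open ≡-Reasoning

-- Makes rational constants such as `½` available as coefficients to the ring solver for series.
constMorphism : CommutativeRing.rawRing ℚₚ.+-*-commutativeRing
  -Raw-AlmostCommutative⟶ fromCommutativeRing powerSeriesRing
constMorphism = record
  { ⟦_⟧    = const
  ; +-homo = λ { x y zero → refl ; x y (suc n) → refl }
  ; *-homo = λ { x y zero → sym (ℚₚ.+-identityʳ (x * y))
               ; x y (suc n) → sym (trans (const-⊛ x (const y) (suc n)) (ℚₚ.*-zeroʳ x)) }
  ; -‿homo = λ { x zero → refl ; x (suc n) → refl }
  ; 0-homo = const-0
  ; 1-homo = ≈-refl
  }

module SeriesSolver = Algebra.Solver.Ring (CommutativeRing.rawRing ℚₚ.+-*-commutativeRing)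
  (fromCommutativeRing powerSeriesRing) constMorphism
  (λ x y → Maybe.map (λ x≡y n → cong (λ z → const z n) x≡y) (dec⇒maybe (x ℚₚ.≟ y)))

open import Algebra.Properties.Semiring.Exp (CommutativeRing.semiring powerSeriesRing)
  using () renaming (_^_ to infixr 8 _^ₛ_)

-- The record wrapper lets both sides be inferred from a proof, which the
-- function type _≈_ does not allow.
infix 4 _≋_
record _≋_ (a b : PowerSeries) : Set where
  constructor ⟪_⟫
  field
    coefficients : a ≈ b
open _≋_

-- Identities of series modulo given relations

record Relation : Set where
  constructor _⊗_
  field
    multiplier {lhs rhs} : PowerSeries
    holds                : lhs ≋ rhs

combination : List Relation → PowerSeries
combination []                       = const 0ℚ
combination (_⊗_ c {a} {b} _ ∷ rels) = c ⊛ (a ⊖ b) ⊕ combination rels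

combination≈0 : ∀ rels → combination rels ≈ const 0ℚ
combination≈0 []                               = λ _ → refl
combination≈0 (_⊗_ c {a} {b} ⟪ a≈b ⟫ ∷ rels) n = begin
  (c ⊛ (a ⊖ b)) n + combination rels n
    ≡⟨ cong₂ _+_ (⊛-congˡ c (λ k → cong (_- b k) (a≈b k)) n) (combination≈0 rels n) ⟩
  (c ⊛ (b ⊖ b)) n + const 0ℚ n
    ≡⟨ solve 2 (λ c b → c :* (b :- b) :+ con 0ℚ := con 0ℚ) (λ _ → refl) c b n ⟩
  const 0ℚ n ∎
  where
  open ≡-Reasoning
  open SeriesSolver

-- A certificate of ideal membership: once the multipliers of the relations are given, the remaining
-- hypothesis is a polynomial identity for the ring solver.
≋-modulo : ∀ rels {x y} → x ⊖ y ≈ combination rels → x ≋ y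
≋-modulo rels {x} {y} x-y≈ = ⟪ (λ n → begin
  x n              ≡⟨ solve 2 (λ x y → x := x :- y :+ y) (λ _ → refl) x y n ⟩
  (x ⊖ y) n + y n  ≡⟨ cong (_+ y n) (trans (x-y≈ n) (combination≈0 rels n)) ⟩
  const 0ℚ n + y n ≡⟨ solve 1 (λ y → con 0ℚ :+ y := y) (λ _ → refl) y n ⟩
  y n              ∎) ⟫
  where
  open ≡-Reasoning
  open SeriesSolver

-- Multiplication by `𝐭` as a shift of coefficients

𝐭-⊛-suc : ∀ a n → (𝐭 ⊛ a) (suc n) ≡ a n
𝐭-⊛-suc a n = begin
  0ℚ * a (suc n) + (tail 𝐭 ⊛ a) n
    ≡⟨ cong₂ _+_ (ℚₚ.*-zeroˡ (a (suc n))) (⊛-congʳ a tail-𝐭 n) ⟩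
  0ℚ + (const 1ℚ ⊛ a) n  ≡⟨ ℚₚ.+-identityˡ _ ⟩
  (const 1ℚ ⊛ a) n       ≡⟨ ⊛-identityˡ a n ⟩
  a n                    ∎
  where
  open ≡-Reasoning
  tail-𝐭 : tail 𝐭 ≈ const 1ℚ
  tail-𝐭 zero    = refl
  tail-𝐭 (suc _) = refl

𝐭-⊛-zero : ∀ a → (𝐭 ⊛ a) 0 ≡ 0ℚ
𝐭-⊛-zero a = trans (ℚₚ.+-identityʳ (0ℚ * a 0)) (ℚₚ.*-zeroˡ (a 0))

𝐭-⊛-cancel : ∀ {a b} → 𝐭 ⊛ a ≋ 𝐭 ⊛ b → a ≋ b
𝐭-⊛-cancel {a} {b} ⟪ ta≈tb ⟫ =
  ⟪ (λ n → trans (sym (𝐭-⊛-suc a n)) (trans (ta≈tb (suc n)) (𝐭-⊛-suc b n))) ⟫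

-- Division by `𝐭`; applied twice, it justifies the definition of `β` from its multiple by t².
𝐭-⊛-tail : ∀ a → a 0 ≡ 0ℚ → 𝐭 ⊛ tail a ≈ a
𝐭-⊛-tail a a₀≡0 zero    = trans (𝐭-⊛-zero (tail a)) (sym a₀≡0)
𝐭-⊛-tail a a₀≡0 (suc n) = 𝐭-⊛-suc (tail a) n

coeff-zero : ∀ {a} c b → a ≋ const c ⊕ 𝐭 ⊛ b → a 0 ≡ c
coeff-zero c b ⟪ a≈ ⟫ = trans (a≈ 0) (trans (cong (c +_) (𝐭-⊛-zero b)) (ℚₚ.+-identityʳ c))

coeff-suc : ∀ {a} c b → a ≋ const c ⊕ 𝐭 ⊛ b → ∀ n → a (suc n) ≡ b n
coeff-suc c b ⟪ a≈ ⟫ n =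
  trans (a≈ (suc n)) (trans (cong (0ℚ +_) (𝐭-⊛-suc b n)) (ℚₚ.+-identityˡ (b n)))

-- The closed form

-- The sign of p - q. Recursion on both arguments makes it invariant by computation under a common
-- shift, as are `𝒯` and `ℋ`, so the recurrences only need proof when p or q is zero.
sgn : ℕ → ℕ → ℚ
sgn zero    zero    = 0ℚ
sgn zero    (suc q) = - 1ℚ
sgn (suc p) zero    = 1ℚ
sgn (suc p) (suc q) = sgn p q

-- With y = t²β the claim is y² - (1-t)y + t³(1-t) = 0. Its discriminant (1-t)(1-t-4t³) is the
-- radicand, and y = ½(1-t-s) is a root.
t²-β-quadratic : ∀ t s β →
  t ⊛ (t ⊛ β) ≋ const ½ ⊛ (const 1ℚ ⊖ t ⊖ s) →
  s ⊛ s ≋ (const 1ℚ ⊖ t) ⊛ (const 1ℚ ⊖ const 2ℚ ⊛ t) ⊛ (const 2ℚ ⊛ (t ⊛ t) ⊕ t ⊕ const 1ℚ) →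
  t ⊛ (t ⊛ ((const 1ℚ ⊖ t) ⊛ (β ⊖ t))) ≋ t ⊛ (t ⊛ (t ⊛ t ⊛ β ⊛ β))
t²-β-quadratic t s β β-root s-square = ≋-modulo
  -- The first multiplier is the cofactor of y - y₀ in the difference of (1-t)y - y² at y = t²β and
  -- y₀ = ½(1-t-s). The second is -¼ because y₀(1-t-y₀) = ¼((1-t)² - s²).
  ( (const 1ℚ ⊖ t ⊖ t ⊛ (t ⊛ β) ⊖ const ½ ⊛ (const 1ℚ ⊖ t ⊖ s)) ⊗ β-root
  ∷ const (- (½ * ½)) ⊗ s-square ∷ [])
  (solve 3 (λ t s β →
      t :* (t :* ((con 1ℚ :- t) :* (β :- t))) :- t :* (t :* (t :* t :* β :* β))
    := (con 1ℚ :- t :- t :* (t :* β) :- con ½ :* (con 1ℚ :- t :- s))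
         :* (t :* (t :* β) :- con ½ :* (con 1ℚ :- t :- s))
       :+ (con (- (½ * ½)) :* (s :* s :- (con 1ℚ :- t) :* (con 1ℚ :- con 2ℚ :* t) :* (con 2ℚ :* (t :* t) :+ t :+ con 1ℚ))
       :+ con 0ℚ))
    (λ _ → refl) t s β)
  where open SeriesSolver

-- `u`, `g` and `v` stand for 1/(1-t), 1/(1-2t) and 1/s. The recurrences and the final formula
-- follow from these five relations by algebra alone.
module ClosedForm (t s u v g β : PowerSeries)
  (u-inverse   : (const 1ℚ ⊖ t) ⊛ u ≋ const 1ℚ)
  (g-inverse   : (const 1ℚ ⊖ const 2ℚ ⊛ t) ⊛ g ≋ const 1ℚ)
  (v-inverse   : s ⊛ v ≋ const 1ℚ)
  (β-root      : t ⊛ (t ⊛ β) ≋ const ½ ⊛ (const 1ℚ ⊖ t ⊖ s))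
  (β-quadratic : (const 1ℚ ⊖ t) ⊛ (β ⊖ t) ≋ t ⊛ t ⊛ β ⊛ β)
  where
  open SeriesSolver

  -- `c` and `e` are the amplitudes of the powers of `β` and `α`. The recurrence of `𝒯` at k = 0
  -- gives `e` in terms of `c`; that of `ℋ` then becomes c(1-t-2t²β) = g(1-α), where 1-t-2t²β = s.
  α c e : PowerSeries
  α = t ⊛ β ⊛ u
  c = g ⊛ v ⊛ (const 1ℚ ⊖ α)
  e = g ⊛ u ⊖ t ⊛ c

  -- The case k = 0 belongs to the `α` branch of `𝒯` but to the `β` branch of `ℋ`. Apart from `g`,
  -- the amplitudes on each branch are in the ratio prescribed by (1-t)𝒯 = tℋ.
  𝒯 ℋ : ℕ → ℕ → PowerSeries
  𝒯 zero    q       = e ⊛ α ^ₛ q ⊖ g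
  𝒯 (suc p) zero    = g ⊖ t ⊛ c ⊛ β ^ₛ suc p
  𝒯 (suc p) (suc q) = 𝒯 p q
  ℋ p       zero    = g ⊖ (const 1ℚ ⊖ t) ⊛ c ⊛ β ^ₛ p
  ℋ zero    (suc q) = β ⊛ e ⊛ α ^ₛ q ⊖ g
  ℋ (suc p) (suc q) = ℋ p q

  private
    -- Each of these mentions only some of the parameters; callers pass arbitrary
    -- placeholders for the others.
    module _ {n} (t u v g β : Polynomial n) where
      :α :c :e :u-inverse :g-inverse :β-quadratic : Polynomial n
      :α = t :* β :* u
      :c = g :* v :* (con 1ℚ :- :α)
      :e = g :* u :- t :* :c
      :u-inverse = (con 1ℚ :- t) :* u :- con 1ℚ
      :g-inverse = (con 1ℚ :- con 2ℚ :* t) :* g :- con 1ℚ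
      :β-quadratic = (con 1ℚ :- t) :* (β :- t) :- t :* t :* β :* β

    :v-inverse : ∀ {n} (s v : Polynomial n) → Polynomial n
    :v-inverse s v = s :* v :- con 1ℚ

    :β-root : ∀ {n} (t s β : Polynomial n) → Polynomial n
    :β-root t s β = t :* (t :* β) :- con ½ :* (con 1ℚ :- t :- s)

  -- For k ≠ 0 the terms ±g absorb the source ±1, since g = 1 + 2tg, and the power terms satisfy
  -- (1-t)𝒯 = tℋ. At k = 0 this is the equation that determines `e`.
  𝒯-recurrence : ∀ p q → 𝒯 p q ≋ const (sgn p q) ⊕ t ⊛ (𝒯 p q ⊕ ℋ p q)
  𝒯-recurrence zero zero = ≋-modulo (g ⊗ u-inverse ∷ [])
    (solve 5 (λ t u v g β → let e = :e t u v g β ; c = :c t u v g β in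
        e :* con 1ℚ :- g
          :- (con 0ℚ :+ t :* (e :* con 1ℚ :- g :+ (g :- (con 1ℚ :- t) :* c :* con 1ℚ)))
      := g :* :u-inverse t u v g β :+ con 0ℚ)
      (λ _ → refl) t u v g β)
  𝒯-recurrence zero (suc q) = ≋-modulo (const (- 1ℚ) ⊗ g-inverse ∷ (e ⊛ α ^ₛ q ⊛ t ⊛ β) ⊗ u-inverse ∷ [])
    (solve 6 (λ t u e g β P → let α = :α t u e g β in
        e :* (α :* P) :- g
          :- (con (- 1ℚ) :+ t :* (e :* (α :* P) :- g :+ (β :* e :* P :- g)))
      := con (- 1ℚ) :* :g-inverse t u e g β :+ (e :* P :* t :* β :* :u-inverse t u e g β :+ con 0ℚ))
      (λ _ → refl) t u e g β (α ^ₛ q))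
  𝒯-recurrence (suc p) zero = ≋-modulo (const 1ℚ ⊗ g-inverse ∷ [])
    (solve 4 (λ t g c P →
        g :- t :* c :* P
          :- (con 1ℚ :+ t :* (g :- t :* c :* P :+ (g :- (con 1ℚ :- t) :* c :* P)))
      := con 1ℚ :* :g-inverse t t t g t :+ con 0ℚ)
      (λ _ → refl) t g c (β ^ₛ suc p))
  𝒯-recurrence (suc p) (suc q) = 𝒯-recurrence p q

  ℋ-recurrence : ∀ p q → ℋ p q ≋ const (sgn p q) ⊕ t ⊛ (ℋ p (suc q) ⊕ 𝒯 (suc p) q)
  -- `β-root` turns 1-t-2t²β into `s`, and `v-inverse` gives s c = g(1-α).
  ℋ-recurrence zero zero = ≋-modulo
    ((const (- 1ℚ) ⊛ g ⊛ (const 1ℚ ⊖ α)) ⊗ v-inverse ∷ (const 2ℚ ⊛ c) ⊗ β-root ∷ [])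
    (solve 6 (λ t s u v g β → let α = :α t u v g β ; e = :e t u v g β ; c = :c t u v g β in
        g :- (con 1ℚ :- t) :* c :* con 1ℚ
          :- (con 0ℚ :+ t :* (β :* e :* con 1ℚ :- g :+ (g :- t :* c :* (β :* con 1ℚ))))
      := con (- 1ℚ) :* g :* (con 1ℚ :- α) :* :v-inverse s v :+ (con 2ℚ :* c :* :β-root t s β :+ con 0ℚ))
      (λ _ → refl) t s u v g β)
  -- Up to the factor e αᵠ the power terms require β = t + tβα, which is `β-quadratic` divided by
  -- 1-t; hence the multiplier `u`.
  ℋ-recurrence zero (suc q) = ≋-modulo
    (const (- 1ℚ) ⊗ g-inverse ∷ (e ⊛ α ^ₛ q ⊛ u) ⊗ β-quadratic
      ∷ (const (- 1ℚ) ⊛ e ⊛ α ^ₛ q ⊛ (β ⊖ t)) ⊗ u-inverse ∷ [])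
    (solve 6 (λ t u e g β P → let α = :α t u e g β in
        β :* e :* P :- g
          :- (con (- 1ℚ) :+ t :* (β :* e :* (α :* P) :- g :+ (e :* P :- g)))
      := con (- 1ℚ) :* :g-inverse t u e g β :+ (e :* P :* u :* :β-quadratic t u e g β
          :+ (con (- 1ℚ) :* e :* P :* (β :- t) :* :u-inverse t u e g β :+ con 0ℚ)))
      (λ _ → refl) t u e g β (α ^ₛ q))
  ℋ-recurrence (suc p) zero = ≋-modulo
    (const 1ℚ ⊗ g-inverse ∷ (const (- 1ℚ) ⊛ c ⊛ β ^ₛ p) ⊗ β-quadratic ∷ [])
    (solve 5 (λ t g c β P →
        g :- (con 1ℚ :- t) :* c :* (β :* P)
          :- (con 1ℚ :+ t :* (g :- (con 1ℚ :- t) :* c :* P :+ (g :- t :* c :* (β :* (β :* P)))))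
      := con 1ℚ :* :g-inverse t t t g t :+ (con (- 1ℚ) :* c :* P :* :β-quadratic t t t g β :+ con 0ℚ))
      (λ _ → refl) t g c β (β ^ₛ p))
  ℋ-recurrence (suc p) (suc q) = ℋ-recurrence p q

  -- By `β-root`, tα = ½(1 - su), so e - g = g(½ - t)(v - u), and g(1-2t) = 1.
  𝒯₀₀-closed : 𝒯 0 0 ≋ const ½ ⊛ v ⊖ const ½ ⊛ u
  𝒯₀₀-closed = ≋-modulo
    ((const ½ ⊛ (v ⊖ u)) ⊗ g-inverse ∷ (g ⊛ (const 1ℚ ⊕ const ½ ⊛ v)) ⊗ u-inverse
      ∷ (g ⊛ u ⊛ v) ⊗ β-root ∷ (const (- ½) ⊛ g ⊛ u) ⊗ v-inverse ∷ [])
    (solve 6 (λ t s u v g β →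
        :e t u v g β :* con 1ℚ :- g :- (con ½ :* v :- con ½ :* u)
      := con ½ :* (v :- u) :* :g-inverse t u v g β :+ (g :* (con 1ℚ :+ con ½ :* v) :* :u-inverse t u v g β
          :+ (g :* u :* v :* :β-root t s β :+ (con (- ½) :* g :* u :* :v-inverse s v :+ con 0ℚ))))
      (λ _ → refl) t s u v g β)

-- The concrete series and their defining relations

𝟏≈const : 𝟏 ≈ const 1ℚ
𝟏≈const zero    = refl
𝟏≈const (suc _) = refl

1-𝐭≈ : 𝟏 ⊖ 𝐭 ≈ const 1ℚ ⊖ 𝐭
1-𝐭≈ n = cong (_- 𝐭 n) (𝟏≈const n)

1-2𝐭≈ : 𝟏 ⊖ 2ℚ · 𝐭 ≈ const 1ℚ ⊖ const 2ℚ ⊛ 𝐭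
1-2𝐭≈ n = cong₂ _-_ (𝟏≈const n) (sym (const-⊛ 2ℚ 𝐭 n))

s u v g β : PowerSeries
s = sqrt radicand refl
u = recip (𝟏 ⊖ 𝐭)
v = recip s
g = recip (𝟏 ⊖ 2ℚ · 𝐭)

u-inverse : (const 1ℚ ⊖ 𝐭) ⊛ u ≋ const 1ℚ
u-inverse = ⟪ (λ n → begin
  ((const 1ℚ ⊖ 𝐭) ⊛ u) n ≡⟨ ⊛-congʳ u 1-𝐭≈ n ⟨
  ((𝟏 ⊖ 𝐭) ⊛ u) n        ≡⟨ recip-inverse (𝟏 ⊖ 𝐭) n ⟩
  𝟏 n                    ≡⟨ 𝟏≈const n ⟩
  const 1ℚ n             ∎) ⟫
  where open ≡-Reasoning

g-inverse : (const 1ℚ ⊖ const 2ℚ ⊛ 𝐭) ⊛ g ≋ const 1ℚ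
g-inverse = ⟪ (λ n → begin
  ((const 1ℚ ⊖ const 2ℚ ⊛ 𝐭) ⊛ g) n ≡⟨ ⊛-congʳ g 1-2𝐭≈ n ⟨
  ((𝟏 ⊖ 2ℚ · 𝐭) ⊛ g) n              ≡⟨ recip-inverse (𝟏 ⊖ 2ℚ · 𝐭) n ⟩
  𝟏 n                               ≡⟨ 𝟏≈const n ⟩
  const 1ℚ n                        ∎) ⟫
  where open ≡-Reasoning

v-inverse : s ⊛ v ≋ const 1ℚ
v-inverse = ⟪ (λ n → trans (recip-inverse s n) (𝟏≈const n)) ⟫

s-square : s ⊛ s ≋ (const 1ℚ ⊖ 𝐭) ⊛ (const 1ℚ ⊖ const 2ℚ ⊛ 𝐭) ⊛ (const 2ℚ ⊛ (𝐭 ⊛ 𝐭) ⊕ 𝐭 ⊕ const 1ℚ)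
s-square = ⟪ (λ n → trans (sqrt-square radicand refl n)
  (⊛-cong {(𝟏 ⊖ 𝐭) ⊛ (𝟏 ⊖ 2ℚ · 𝐭)} {(const 1ℚ ⊖ 𝐭) ⊛ (const 1ℚ ⊖ const 2ℚ ⊛ 𝐭)}
    (⊛-cong {𝟏 ⊖ 𝐭} {const 1ℚ ⊖ 𝐭} 1-𝐭≈ 1-2𝐭≈)
    (λ k → cong₂ _+_ (cong (_+ 𝐭 k) (sym (const-⊛ 2ℚ (𝐭 ⊛ 𝐭) k))) (𝟏≈const k)) n)) ⟫

½[1-𝐭-s] : PowerSeries
½[1-𝐭-s] = const ½ ⊛ (const 1ℚ ⊖ 𝐭 ⊖ s)

β = tail (tail ½[1-𝐭-s])

β-root : 𝐭 ⊛ (𝐭 ⊛ β) ≋ const ½ ⊛ (const 1ℚ ⊖ 𝐭 ⊖ s)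
β-root = ⟪ (λ n → trans
  -- The two `refl` check by computation that `½[1-𝐭-s]` has no terms in t⁰ and t¹, so that taking
  -- `tail` twice divides it by t².
  (⊛-congˡ 𝐭 (𝐭-⊛-tail (tail ½[1-𝐭-s]) refl) n)
  (𝐭-⊛-tail ½[1-𝐭-s] refl n)) ⟫

β-quadratic : (const 1ℚ ⊖ 𝐭) ⊛ (β ⊖ 𝐭) ≋ 𝐭 ⊛ 𝐭 ⊛ β ⊛ β
β-quadratic = 𝐭-⊛-cancel (𝐭-⊛-cancel (t²-β-quadratic 𝐭 s β β-root s-square))

open ClosedForm 𝐭 s u v g β u-inverse g-inverse v-inverse β-root β-quadratic

𝒯-zero : ∀ p q → 𝒯 p q 0 ≡ sgn p q
𝒯-zero p q = coeff-zero (sgn p q) (𝒯 p q ⊕ ℋ p q) (𝒯-recurrence p q)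

𝒯-suc : ∀ p q n → 𝒯 p q (suc n) ≡ 𝒯 p q n + ℋ p q n
𝒯-suc p q = coeff-suc (sgn p q) (𝒯 p q ⊕ ℋ p q) (𝒯-recurrence p q)

ℋ-zero : ∀ p q → ℋ p q 0 ≡ sgn p q
ℋ-zero p q = coeff-zero (sgn p q) (ℋ p (suc q) ⊕ 𝒯 (suc p) q) (ℋ-recurrence p q)

ℋ-suc : ∀ p q n → ℋ p q (suc n) ≡ ℋ p (suc q) n + 𝒯 (suc p) q n
ℋ-suc p q = coeff-suc (sgn p q) (ℋ p (suc q) ⊕ 𝒯 (suc p) q) (ℋ-recurrence p q)

-- Sums of signs over the outcomes

ι : ℕ → ℚ
ι m = ℤ.+ m / 1

/-*-ι : ∀ m d .{{_ : ℕ.NonZero d}} → (ℤ.+ m / d) * ι d ≡ ι m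
/-*-ι m (suc d) = ℚₚ.toℚᵘ-injective (begin
  toℚᵘ ((ℤ.+ m / suc d) * ι (suc d))            ≈⟨ ℚₚ.toℚᵘ-homo-* (ℤ.+ m / suc d) (ι (suc d)) ⟩
  toℚᵘ (ℤ.+ m / suc d) ℚᵘ.* toℚᵘ (ι (suc d))
    ≈⟨ ℚᵘₚ.*-cong (ℚₚ.toℚᵘ-fromℚᵘ (mkℚᵘ (ℤ.+ m) d)) (ℚₚ.toℚᵘ-fromℚᵘ (mkℚᵘ (ℤ.+ suc d) 0)) ⟩
  mkℚᵘ (ℤ.+ m) d ℚᵘ.* mkℚᵘ (ℤ.+ suc d) 0          ≈⟨ *≡* (ℤₚ.*-assoc (ℤ.+ m) (ℤ.+ suc d) (ℤ.+ 1)) ⟩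
  mkℚᵘ (ℤ.+ m) 0                                ≈⟨ ℚₚ.toℚᵘ-fromℚᵘ (mkℚᵘ (ℤ.+ m) 0) ⟨
  toℚᵘ (ι m)                                  ∎)
  where open ℚᵘₚ.≃-Reasoning

ι-suc : ∀ m → ι (suc m) ≡ 1ℚ + ι m
ι-suc m = ℚₚ.toℚᵘ-injective (begin
  toℚᵘ (ι (suc m))            ≈⟨ ℚₚ.toℚᵘ-fromℚᵘ (mkℚᵘ (ℤ.+ suc m) 0) ⟩
  mkℚᵘ (ℤ.+ suc m) 0
    ≈⟨ *≡* (cong (λ k → (ℤ.+ 1 ℤ.+ k) ℤ.* ℤ.+ 1) (sym (ℤₚ.*-identityʳ (ℤ.+ m)))) ⟩
  toℚᵘ 1ℚ ℚᵘ.+ mkℚᵘ (ℤ.+ m) 0   ≈⟨ ℚᵘₚ.+-congʳ (toℚᵘ 1ℚ) (ℚₚ.toℚᵘ-fromℚᵘ (mkℚᵘ (ℤ.+ m) 0)) ⟨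
  toℚᵘ 1ℚ ℚᵘ.+ toℚᵘ (ι m)     ≈⟨ ℚₚ.toℚᵘ-homo-+ 1ℚ (ι m) ⟨
  toℚᵘ (1ℚ + ι m)             ∎)
  where open ℚᵘₚ.≃-Reasoning

ι-+ : ∀ m n → ι (m ℕ.+ n) ≡ ι m + ι n
ι-+ zero    n = sym (ℚₚ.+-identityˡ (ι n))
ι-+ (suc m) n = begin
  ι (suc (m ℕ.+ n))   ≡⟨ ι-suc (m ℕ.+ n) ⟩
  1ℚ + ι (m ℕ.+ n)    ≡⟨ cong (1ℚ +_) (ι-+ m n) ⟩
  1ℚ + (ι m + ι n)    ≡⟨ ℚₚ.+-assoc 1ℚ (ι m) (ι n) ⟨
  1ℚ + ι m + ι n      ≡⟨ cong (_+ ι n) (ι-suc m) ⟨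
  ι (suc m) + ι n     ∎
  where open ≡-Reasoning

2^-suc : ∀ n → 2ℚ ^ suc n ≡ 2ℚ ^ n + 2ℚ ^ n
2^-suc n = solve 1 (λ x → con 2ℚ :* x := x :+ x) refl (2ℚ ^ n)
  where open +-*-Solver

ι-2^ : ∀ n → ι (2 ℕ.^ n) ≡ 2ℚ ^ n
ι-2^ zero    = refl
ι-2^ (suc n) = begin
  ι (2 ℕ.^ n ℕ.+ (2 ℕ.^ n ℕ.+ 0))    ≡⟨ ι-+ (2 ℕ.^ n) _ ⟩
  ι (2 ℕ.^ n) + ι (2 ℕ.^ n ℕ.+ 0)    ≡⟨ cong (λ k → ι (2 ℕ.^ n) + ι k) (ℕₚ.+-identityʳ (2 ℕ.^ n)) ⟩
  ι (2 ℕ.^ n) + ι (2 ℕ.^ n)          ≡⟨ cong₂ _+_ (ι-2^ n) (ι-2^ n) ⟩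
  2ℚ ^ n + 2ℚ ^ n                    ≡⟨ 2^-suc n ⟨
  2ℚ ^ suc n                         ∎
  where open ≡-Reasoning

sgn-> : ∀ {p q} → q ℕ.< p → sgn p q ≡ 1ℚ
sgn-> {suc p} {zero}  _         = refl
sgn-> {suc p} {suc q} (s≤s q<p) = sgn-> q<p

sgn-< : ∀ {p q} → p ℕ.< q → sgn p q ≡ - 1ℚ
sgn-< {zero}  {suc q} _         = refl
sgn-< {suc p} {suc q} (s≤s p<q) = sgn-< p<q

sgn-refl : ∀ p → sgn p p ≡ 0ℚ
sgn-refl zero    = refl
sgn-refl (suc p) = sgn-refl p

∣sgn∣≤1 : ∀ p q → ∣ sgn p q ∣ ≤ 1ℚ
∣sgn∣≤1 zero    zero    = ℚₚ.nonNegative⁻¹ 1ℚ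
∣sgn∣≤1 zero    (suc q) = ℚₚ.≤-refl
∣sgn∣≤1 (suc p) zero    = ℚₚ.≤-refl
∣sgn∣≤1 (suc p) (suc q) = ∣sgn∣≤1 p q

sumOf : ∀ {A : Set} → (A → ℚ) → List A → ℚ
sumOf φ []       = 0ℚ
sumOf φ (x ∷ xs) = φ x + sumOf φ xs

sumOf-cong : ∀ {A : Set} {φ ψ : A → ℚ} → (∀ x → φ x ≡ ψ x) → ∀ xs → sumOf φ xs ≡ sumOf ψ xs
sumOf-cong φ≗ψ []       = refl
sumOf-cong φ≗ψ (x ∷ xs) = cong₂ _+_ (φ≗ψ x) (sumOf-cong φ≗ψ xs)

sumOf-++ : ∀ {A : Set} (φ : A → ℚ) xs ys → sumOf φ (xs ++ ys) ≡ sumOf φ xs + sumOf φ ys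
sumOf-++ φ []       ys = sym (ℚₚ.+-identityˡ (sumOf φ ys))
sumOf-++ φ (x ∷ xs) ys =
  trans (cong (φ x +_) (sumOf-++ φ xs ys)) (sym (ℚₚ.+-assoc (φ x) (sumOf φ xs) (sumOf φ ys)))

sumOf-map : ∀ {A B : Set} (φ : B → ℚ) (h : A → B) xs → sumOf φ (map h xs) ≡ sumOf (φ ∘ h) xs
sumOf-map φ h []       = refl
sumOf-map φ h (x ∷ xs) = cong (φ (h x) +_) (sumOf-map φ h xs)

sumOf-outcomes-suc : ∀ n (φ : Vec Coin (suc n) → ℚ) →
  sumOf φ (outcomes (suc n)) ≡ sumOf (φ ∘ (H ∷_)) (outcomes n) + sumOf (φ ∘ (T ∷_)) (outcomes n)
sumOf-outcomes-suc n φ = trans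
  (sumOf-++ φ (map (H ∷_) (outcomes n)) (map (T ∷_) (outcomes n)))
  (cong₂ _+_ (sumOf-map φ (H ∷_) (outcomes n)) (sumOf-map φ (T ∷_) (outcomes n)))

-- Trichotomy at each element. The difference of two counts becomes a single sum, to which a
-- recurrence applies.
sumOf-sgn : ∀ {A : Set} (b a : A → ℕ) xs →
  sumOf (λ x → sgn (b x) (a x)) xs ≡
  ι (length (filter (λ x → a x ℕₚ.<? b x) xs)) - ι (length (filter (λ x → b x ℕₚ.<? a x) xs))
sumOf-sgn b a []       = refl
sumOf-sgn b a (x ∷ xs) = trans (cong (sgn (b x) (a x) +_) (sumOf-sgn b a xs)) (step (ℕₚ.<-cmp (a x) (b x)))
  where
  open ≡-Reasoning
  open +-*-Solver
  B? = λ y → a y ℕₚ.<? b y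
  A? = λ y → b y ℕₚ.<? a y
  m k : List _ → ℚ
  m ys = ι (length (filter B? ys))
  k ys = ι (length (filter A? ys))
  accept : ∀ {P : _ → Set} (P? : ∀ y → Dec (P y)) → P x →
    ι (length (filter P? (x ∷ xs))) ≡ 1ℚ + ι (length (filter P? xs))
  accept P? Px = trans (cong (ι ∘ length) (filter-accept P? Px)) (ι-suc (length (filter P? xs)))
  reject : ∀ {P : _ → Set} (P? : ∀ y → Dec (P y)) → ¬ P x →
    ι (length (filter P? (x ∷ xs))) ≡ ι (length (filter P? xs))
  reject P? ¬Px = cong (ι ∘ length) (filter-reject P? ¬Px)
  step : Tri (a x ℕ.< b x) (a x ≡ b x) (b x ℕ.< a x) →
    sgn (b x) (a x) + (m xs - k xs) ≡ m (x ∷ xs) - k (x ∷ xs)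
  step (tri< a<b _ a≯b) = begin
    sgn (b x) (a x) + (m xs - k xs)  ≡⟨ cong (_+ (m xs - k xs)) (sgn-> a<b) ⟩
    1ℚ + (m xs - k xs)               ≡⟨ ℚₚ.+-assoc 1ℚ (m xs) (- k xs) ⟨
    1ℚ + m xs - k xs                 ≡⟨ cong₂ _-_ (accept B? a<b) (reject A? a≯b) ⟨
    m (x ∷ xs) - k (x ∷ xs)          ∎
  step (tri≈ a≮b a≡b a≯b) = begin
    sgn (b x) (a x) + (m xs - k xs)  ≡⟨ cong (λ y → sgn (b x) y + (m xs - k xs)) a≡b ⟩
    sgn (b x) (b x) + (m xs - k xs)  ≡⟨ cong (_+ (m xs - k xs)) (sgn-refl (b x)) ⟩
    0ℚ + (m xs - k xs)               ≡⟨ ℚₚ.+-identityˡ (m xs - k xs) ⟩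
    m xs - k xs                      ≡⟨ cong₂ _-_ (reject B? a≮b) (reject A? a≯b) ⟨
    m (x ∷ xs) - k (x ∷ xs)          ∎
  step (tri> a≮b _ a>b) = begin
    sgn (b x) (a x) + (m xs - k xs)  ≡⟨ cong (_+ (m xs - k xs)) (sgn-< a>b) ⟩
    - 1ℚ + (m xs - k xs)
      ≡⟨ solve 2 (λ y z → con (- 1ℚ) :+ (y :- z) := y :- (con 1ℚ :+ z)) refl (m xs) (k xs) ⟩
    m xs - (1ℚ + k xs)               ≡⟨ cong₂ _-_ (reject B? a≮b) (accept A? a>b) ⟨
    m (x ∷ xs) - k (x ∷ xs)          ∎

probability-*-2^ : ∀ {n} {E : Pred (Vec Coin n) 0ℓ} (E? : Decidable E) →
  probability E? * 2ℚ ^ n ≡ ι (length (filter E? (outcomes n)))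
probability-*-2^ {n} E? = trans (cong (probability E? *_) (sym (ι-2^ n)))
  (/-*-ι (length (filter E? (outcomes n))) (2 ℕ.^ n) {{ℕₚ.m^n≢0 2 n}})

-- The factor 2ⁿ in `f` clears the denominators of both probabilities.
f-as-sum : ∀ n → f n ≡ sumOf (λ xs → sgn (bob xs) (alice xs)) (outcomes n)
f-as-sum n = begin
  (P-Bob n - P-Alice n) * 2ℚ ^ n
    ≡⟨ solve 3 (λ x y z → (x :- y) :* z := x :* z :- y :* z) refl (P-Bob n) (P-Alice n) (2ℚ ^ n) ⟩
  P-Bob n * 2ℚ ^ n - P-Alice n * 2ℚ ^ n
    ≡⟨ cong₂ _-_ (probability-*-2^ {n} (λ xs → alice xs ℕₚ.<? bob xs))
                 (probability-*-2^ {n} (λ xs → bob xs ℕₚ.<? alice xs)) ⟩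
  ι (length (filter (λ xs → alice xs ℕₚ.<? bob xs) (outcomes n)))
    - ι (length (filter (λ xs → bob xs ℕₚ.<? alice xs) (outcomes n)))
    ≡⟨ sumOf-sgn bob alice (outcomes n) ⟨
  sumOf (λ xs → sgn (bob xs) (alice xs)) (outcomes n) ∎
  where
  open ≡-Reasoning
  open +-*-Solver

-- Recurrences of the sign sums and comparison with the closed form

signSum : Coin → ℕ → ℕ → ℕ → ℚ
signSum x p q n = sumOf (λ xs → sgn (p ℕ.+ bob (x ∷ xs)) (q ℕ.+ alice (x ∷ xs))) (outcomes n)

signSum-zero : ∀ x p q → signSum x p q 0 ≡ sgn p q
signSum-zero x p q = trans (ℚₚ.+-identityʳ _) (cong₂ sgn (ℕₚ.+-identityʳ p) (ℕₚ.+-identityʳ q))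

signSum-T-suc : ∀ p q n → signSum T p q (suc n) ≡ signSum T p q n + signSum H p q n
signSum-T-suc p q n = trans (sumOf-outcomes-suc n _) (ℚₚ.+-comm (signSum H p q n) (signSum T p q n))

-- After H, a flip H scores for Alice and T for Bob; `+-suc` moves the point into the head start `q`
-- or `p`.
signSum-H-suc : ∀ p q n → signSum H p q (suc n) ≡ signSum H p (suc q) n + signSum T (suc p) q n
signSum-H-suc p q n = trans (sumOf-outcomes-suc n _) (cong₂ _+_
  (sumOf-cong (λ xs → cong (sgn (p ℕ.+ bob (H ∷ xs))) (ℕₚ.+-suc q (alice (H ∷ xs)))) (outcomes n))
  (sumOf-cong (λ xs → cong (λ k → sgn k (q ℕ.+ alice (T ∷ xs))) (ℕₚ.+-suc p (bob (T ∷ xs)))) (outcomes n)))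

-- Prepending T creates no scoring pair.
f≡signSum : ∀ n → f n ≡ signSum T 0 0 n
f≡signSum n = trans (f-as-sum n) (sumOf-cong score-T∷ (outcomes n))
  where
  score-T∷ : ∀ {n} (xs : Vec Coin n) → sgn (bob xs) (alice xs) ≡ sgn (bob (T ∷ xs)) (alice (T ∷ xs))
  score-T∷ []       = refl
  score-T∷ (H ∷ xs) = refl
  score-T∷ (T ∷ xs) = refl

mutual
  -- Sign sums and coefficients have the same initial values and the same recurrences in n. The
  -- induction is for all p and q at once, because the step from H changes them.
  signSum-T≡𝒯 : ∀ p q n → signSum T p q n ≡ 𝒯 p q n
  signSum-T≡𝒯 p q zero    = trans (signSum-zero T p q) (sym (𝒯-zero p q))
  signSum-T≡𝒯 p q (suc n) = begin
    signSum T p q (suc n)             ≡⟨ signSum-T-suc p q n ⟩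
    signSum T p q n + signSum H p q n ≡⟨ cong₂ _+_ (signSum-T≡𝒯 p q n) (signSum-H≡ℋ p q n) ⟩
    𝒯 p q n + ℋ p q n                 ≡⟨ 𝒯-suc p q n ⟨
    𝒯 p q (suc n)                     ∎
    where open ≡-Reasoning

  signSum-H≡ℋ : ∀ p q n → signSum H p q n ≡ ℋ p q n
  signSum-H≡ℋ p q zero    = trans (signSum-zero H p q) (sym (ℋ-zero p q))
  signSum-H≡ℋ p q (suc n) = begin
    signSum H p q (suc n)            ≡⟨ signSum-H-suc p q n ⟩
    signSum H p (suc q) n + signSum T (suc p) q n
      ≡⟨ cong₂ _+_ (signSum-H≡ℋ p (suc q) n) (signSum-T≡𝒯 (suc p) q n) ⟩
    ℋ p (suc q) n + 𝒯 (suc p) q n    ≡⟨ ℋ-suc p q n ⟨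
    ℋ p q (suc n)                    ∎
    where open ≡-Reasoning

-- Growth of the coefficients

∣+∣≤2^ : ∀ n {x y z} → x ≡ y + z → ∣ y ∣ ≤ 2ℚ ^ n → ∣ z ∣ ≤ 2ℚ ^ n → ∣ x ∣ ≤ 2ℚ ^ suc n
∣+∣≤2^ n {x} {y} {z} x≡y+z ∣y∣≤ ∣z∣≤ = begin
  ∣ x ∣            ≡⟨ cong ∣_∣ x≡y+z ⟩
  ∣ y + z ∣        ≤⟨ ℚₚ.∣p+q∣≤∣p∣+∣q∣ y z ⟩
  ∣ y ∣ + ∣ z ∣    ≤⟨ ℚₚ.+-mono-≤ ∣y∣≤ ∣z∣≤ ⟩
  2ℚ ^ n + 2ℚ ^ n  ≡⟨ 2^-suc n ⟨
  2ℚ ^ suc n       ∎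
  where open ℚₚ.≤-Reasoning

∣signSum∣≤2^ : ∀ x p q n → ∣ signSum x p q n ∣ ≤ 2ℚ ^ n
∣signSum∣≤2^ x p q zero    = ℚₚ.≤-trans (ℚₚ.≤-reflexive (cong ∣_∣ (signSum-zero x p q))) (∣sgn∣≤1 p q)
∣signSum∣≤2^ H p q (suc n) = ∣+∣≤2^ n (signSum-H-suc p q n) (∣signSum∣≤2^ H p (suc q) n) (∣signSum∣≤2^ T (suc p) q n)
∣signSum∣≤2^ T p q (suc n) = ∣+∣≤2^ n (signSum-T-suc p q n) (∣signSum∣≤2^ T p q n) (∣signSum∣≤2^ H p q n)

∣f∣≤2^ : ∀ n → ∣ f n ∣ ≤ 2ℚ ^ n
∣f∣≤2^ n = ℚₚ.≤-trans (ℚₚ.≤-reflexive (cong ∣_∣ (f≡signSum n))) (∣signSum∣≤2^ T 0 0 n)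

-- Convergence

0≤ι : ∀ k → 0ℚ ≤ ι k
0≤ι k = ℚₚ.nonNegative⁻¹ (ι k) {{ℚₚ.normalize-nonNeg k 1}}

1≤ι-suc : ∀ k → 1ℚ ≤ ι (suc k)
1≤ι-suc k = begin
  1ℚ        ≤⟨ ℚₚ.+-monoʳ-≤ 1ℚ (0≤ι k) ⟩
  1ℚ + ι k  ≡⟨ ι-suc k ⟨
  ι (suc k) ∎
  where open ℚₚ.≤-Reasoning

ι-suc≤2^ : ∀ k → ι (suc k) ≤ 2ℚ ^ k
ι-suc≤2^ zero    = ℚₚ.≤-refl
ι-suc≤2^ (suc k) = begin
  ι (suc (suc k))  ≡⟨ ι-suc (suc k) ⟩
  1ℚ + ι (suc k)   ≤⟨ ℚₚ.+-mono-≤ (ℚₚ.≤-trans (1≤ι-suc k) (ι-suc≤2^ k)) (ι-suc≤2^ k) ⟩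
  2ℚ ^ k + 2ℚ ^ k  ≡⟨ 2^-suc k ⟨
  2ℚ ^ suc k       ∎
  where open ℚₚ.≤-Reasoning

0≤2^ : ∀ n → 0ℚ ≤ 2ℚ ^ n
0≤2^ n = ℚₚ.≤-trans (0≤ι (suc n)) (ι-suc≤2^ n)

^-*-distrib : ∀ x y n → (x * y) ^ n ≡ x ^ n * y ^ n
^-*-distrib x y zero    = refl
^-*-distrib x y (suc n) = trans (cong (x * y *_) (^-*-distrib x y n))
  (solve 4 (λ x y p q → x :* y :* (p :* q) := x :* p :* (y :* q)) refl x y (x ^ n) (y ^ n))
  where open +-*-Solver

1^ : ∀ n → 1ℚ ^ n ≡ 1ℚ
1^ zero    = refl
1^ (suc n) = trans (ℚₚ.*-identityˡ (1ℚ ^ n)) (1^ n)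

0≤½^ : ∀ n → 0ℚ ≤ ½ ^ n
0≤½^ zero    = ℚₚ.nonNegative⁻¹ 1ℚ
0≤½^ (suc n) = begin
  0ℚ          ≡⟨ ℚₚ.*-zeroʳ ½ ⟨
  ½ * 0ℚ      ≤⟨ ℚₚ.*-monoˡ-≤-nonNeg ½ (0≤½^ n) ⟩
  ½ * ½ ^ n   ∎
  where open ℚₚ.≤-Reasoning

-- ε times its denominator is its numerator, which is a positive integer.
archimedean : ∀ ε → 0ℚ < ε → 1ℚ ≤ ε * ι (↧ₙ ε)
archimedean ε 0<ε with positive 0<ε
archimedean ε@(mkℚ (ℤ.+ suc p) d-1 _) 0<ε | _ = begin
  1ℚ                                   ≤⟨ 1≤ι-suc p ⟩
  ι (suc p)                            ≡⟨ /-*-ι (suc p) (suc d-1) ⟨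
  (ℤ.+ suc p / suc d-1) * ι (suc d-1)  ≡⟨ cong (_* ι (suc d-1)) (ℚₚ.↥p/↧p≡p ε) ⟩
  ε * ι (suc d-1)                      ∎
  where open ℚₚ.≤-Reasoning

-- With k the denominator of ε, 1 ≤ εk < ε(k+1) ≤ ε2ᵏ.
½^<ε : ∀ ε → 0ℚ < ε → ½ ^ ↧ₙ ε < ε
½^<ε ε 0<ε = ℚₚ.*-cancelʳ-<-nonNeg (2ℚ ^ k) {{nonNegative (0≤2^ k)}} (begin-strict
  ½ ^ k * 2ℚ ^ k    ≡⟨ ^-*-distrib ½ 2ℚ k ⟨
  1ℚ ^ k            ≡⟨ 1^ k ⟩
  1ℚ                ≤⟨ archimedean ε 0<ε ⟩
  ε * ι k           <⟨ ℚₚ.*-monoʳ-<-pos ε {{positive 0<ε}} ι<ι-suc ⟩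
  ε * ι (suc k)     ≤⟨ ℚₚ.*-monoˡ-≤-nonNeg ε {{nonNegative (ℚₚ.<⇒≤ 0<ε)}} (ι-suc≤2^ k) ⟩
  ε * 2ℚ ^ k        ∎)
  where
  open ℚₚ.≤-Reasoning
  k = ↧ₙ ε
  ι<ι-suc : ι k < ι (suc k)
  ι<ι-suc = begin-strict
    ι k        ≡⟨ ℚₚ.+-identityˡ (ι k) ⟨
    0ℚ + ι k   <⟨ ℚₚ.+-monoˡ-< (ι k) (ℚₚ.positive⁻¹ 1ℚ) ⟩
    1ℚ + ι k   ≡⟨ ι-suc k ⟨
    ι (suc k)  ∎

∑-suc : ∀ (b : ℕ → ℚ) n → ∑[ i < suc n ] b (toℕ i) ≡ ∑[ i < n ] b (toℕ i) + b n
∑-suc b n = trans (sum-init-last {n} (λ i → b (toℕ i)))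
  (cong₂ _+_ (sum-cong-≗ {n} λ i → cong b (toℕ-inject₁ i)) (cong b (toℕ-fromℕ n)))

≤∧≤⇒∣-∣≤ : ∀ {x y d} → x - y ≤ d → y - x ≤ d → ∣ x - y ∣ ≤ d
≤∧≤⇒∣-∣≤ {x} {y} x-y≤d y-x≤d with ℚₚ.∣p∣≡p∨∣p∣≡-p (x - y)
... | inj₁ eq rewrite eq = x-y≤d
... | inj₂ eq rewrite eq = ℚₚ.≤-trans (ℚₚ.≤-reflexive (solve 2 (λ x y → :- (x :- y) := y :- x) refl x y)) y-x≤d
  where open +-*-Solver

module GeometricComparison (b : ℕ → ℚ) (0≤b : ∀ n → 0ℚ ≤ b n) (b≤½^ : ∀ n → b n ≤ ½ ^ n) where
  open ℚₚ.≤-Reasoning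
  open +-*-Solver

  S : ℕ → ℚ
  S n = ∑[ i < n ] b (toℕ i)

  S-increasing : ∀ {m n} → m ℕ.≤′ n → S m ≤ S n
  S-increasing ℕ.≤′-refl            = ℚₚ.≤-refl
  S-increasing {m} (ℕ.≤′-step {n} m≤n) = begin
    S m        ≤⟨ S-increasing m≤n ⟩
    S n        ≡⟨ ℚₚ.+-identityʳ (S n) ⟨
    S n + 0ℚ   ≤⟨ ℚₚ.+-monoʳ-≤ (S n) (0≤b n) ⟩
    S n + b n  ≡⟨ ∑-suc b n ⟨
    S (suc n)  ∎

  -- `2ℚ * ½ ^ n` is the geometric tail from n on; it drops by ½ⁿ at each step, at least as much as
  -- `S` gains.
  S+2½^-decreasing : ∀ {m n} → m ℕ.≤′ n → S n + 2ℚ * ½ ^ n ≤ S m + 2ℚ * ½ ^ m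
  S+2½^-decreasing ℕ.≤′-refl            = ℚₚ.≤-refl
  S+2½^-decreasing {m} (ℕ.≤′-step {n} m≤n) = begin
    S (suc n) + 2ℚ * (½ * ½ ^ n)     ≡⟨ cong (_+ 2ℚ * (½ * ½ ^ n)) (∑-suc b n) ⟩
    S n + b n + 2ℚ * (½ * ½ ^ n)
      ≤⟨ ℚₚ.+-monoˡ-≤ (2ℚ * (½ * ½ ^ n)) (ℚₚ.+-monoʳ-≤ (S n) (b≤½^ n)) ⟩
    S n + ½ ^ n + 2ℚ * (½ * ½ ^ n)
      ≡⟨ solve 2 (λ x h → x :+ h :+ con 2ℚ :* (con ½ :* h) := x :+ con 2ℚ :* h) refl (S n) (½ ^ n) ⟩
    S n + 2ℚ * ½ ^ n                 ≤⟨ S+2½^-decreasing m≤n ⟩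
    S m + 2ℚ * ½ ^ m                 ∎

  -- From N on, all partial sums lie between `S N` and `S N + 2ℚ * ½ ^ N`.
  S-difference : ∀ {N m n} → N ℕ.≤ m → N ℕ.≤ n → S m - S n ≤ 2ℚ * ½ ^ N
  S-difference {N} {m} {n} N≤m N≤n = begin
    S m - S n                         ≤⟨ ℚₚ.+-monoʳ-≤ (S m) (ℚₚ.neg-antimono-≤ (S-increasing (ℕₚ.≤⇒≤′ N≤n))) ⟩
    S m - S N                         ≡⟨ cong (_- S N) (ℚₚ.+-identityʳ (S m)) ⟨
    S m + 0ℚ - S N
      ≤⟨ ℚₚ.+-monoˡ-≤ (- S N) (ℚₚ.+-monoʳ-≤ (S m) (ℚₚ.*-monoˡ-≤-nonNeg 2ℚ (0≤½^ m))) ⟩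
    S m + 2ℚ * ½ ^ m - S N            ≤⟨ ℚₚ.+-monoˡ-≤ (- S N) (S+2½^-decreasing (ℕₚ.≤⇒≤′ N≤m)) ⟩
    S N + 2ℚ * ½ ^ N - S N            ≡⟨ solve 2 (λ x h → x :+ h :- x := h) refl (S N) (2ℚ * ½ ^ N) ⟩
    2ℚ * ½ ^ N                        ∎

  cauchy : Cauchy S
  -- The successor supplies a factor ½ that cancels the 2 of the tail bound.
  cauchy ε 0<ε = suc (↧ₙ ε) , λ m n N≤m N≤n → begin-strict
    ∣ S m - S n ∣        ≤⟨ ≤∧≤⇒∣-∣≤ {S m} {S n} (S-difference N≤m N≤n) (S-difference N≤n N≤m) ⟩
    2ℚ * (½ * ½ ^ ↧ₙ ε)  ≡⟨ solve 1 (λ h → con 2ℚ :* (con ½ :* h) := h) refl (½ ^ ↧ₙ ε) ⟩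
    ½ ^ ↧ₙ ε             <⟨ ½^<ε ε 0<ε ⟩
    ε                    ∎

∣y*t^n∣≤½^n : ∀ {y t} n → ∣ y ∣ ≤ 2ℚ ^ n → ∣ t ∣ ≤ ½ * ½ → ∣ y * t ^ n ∣ ≤ ½ ^ n
∣y*t^n∣≤½^n {y} {t} n ∣y∣≤ ∣t∣≤ = begin
  ∣ y * t ^ n ∣               ≡⟨ ℚₚ.∣p*q∣≡∣p∣*∣q∣ y (t ^ n) ⟩
  ∣ y ∣ * ∣ t ^ n ∣           ≤⟨ ℚₚ.*-monoʳ-≤-nonNeg ∣ t ^ n ∣ {{ℚₚ.∣-∣-nonNeg (t ^ n)}} ∣y∣≤ ⟩
  2ℚ ^ n * ∣ t ^ n ∣          ≤⟨ ℚₚ.*-monoˡ-≤-nonNeg (2ℚ ^ n) {{nonNegative (0≤2^ n)}} (∣t^∣≤ n) ⟩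
  2ℚ ^ n * (½ * ½) ^ n        ≡⟨ ^-*-distrib 2ℚ (½ * ½) n ⟨
  ½ ^ n                       ∎
  where
  open ℚₚ.≤-Reasoning
  ∣t^∣≤ : ∀ n → ∣ t ^ n ∣ ≤ (½ * ½) ^ n
  ∣t^∣≤ zero    = ℚₚ.≤-refl
  ∣t^∣≤ (suc n) = begin
    ∣ t * t ^ n ∣           ≡⟨ ℚₚ.∣p*q∣≡∣p∣*∣q∣ t (t ^ n) ⟩
    ∣ t ∣ * ∣ t ^ n ∣       ≤⟨ ℚₚ.*-monoʳ-≤-nonNeg ∣ t ^ n ∣ {{ℚₚ.∣-∣-nonNeg (t ^ n)}} ∣t∣≤ ⟩
    ½ * ½ * ∣ t ^ n ∣       ≤⟨ ℚₚ.*-monoˡ-≤-nonNeg (½ * ½) (∣t^∣≤ n) ⟩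
    ½ * ½ * (½ * ½) ^ n     ∎

-- The radius is ¼: there the n-th term is at most 2ⁿ · 4⁻ⁿ = ½ⁿ in absolute value.
∣a∣≤2^⇒converges : ∀ a → (∀ n → ∣ a n ∣ ≤ 2ℚ ^ n) → ConvergesNearZero a
∣a∣≤2^⇒converges a ∣a∣≤ = ½ * ½ , ℚₚ.positive⁻¹ (½ * ½) , λ t ∣t∣≤¼ →
  GeometricComparison.cauchy (λ n → ∣ a n * t ^ n ∣)
    (λ n → ℚₚ.0≤∣p∣ (a n * t ^ n)) (λ n → ∣y*t^n∣≤½^n n (∣a∣≤ n) ∣t∣≤¼)

mainTheorem1 : (f ≈ ½ · recip (sqrt radicand refl) ⊖ ½ · recip (𝟏 ⊖ 𝐭)) × ConvergesNearZero f
mainTheorem1 = f-closed , ∣a∣≤2^⇒converges f ∣f∣≤2^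
  where
  open ≡-Reasoning
  f-closed : f ≈ ½ · v ⊖ ½ · u
  f-closed n = begin
    f n                                  ≡⟨ f≡signSum n ⟩
    signSum T 0 0 n                      ≡⟨ signSum-T≡𝒯 0 0 n ⟩
    𝒯 0 0 n                              ≡⟨ coefficients 𝒯₀₀-closed n ⟩
    (const ½ ⊛ v) n - (const ½ ⊛ u) n    ≡⟨ cong₂ _-_ (const-⊛ ½ v n) (const-⊛ ½ u n) ⟩
    ½ * v n - ½ * u n                    ∎
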